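{- Let $\mathcal{P}_g$ be the family of planar graphs having girth at least $g$. Then the game $BS_n(\mathcal{P}_g : t_1, t_2, \dots, t_n)$ ends exactly after $n-1$ moves for all $g \geq 2n+1$.
   Context: The girth of a graph is the length of a shortest cycle (infinite if there is no cycle). A set of graphs $\mathcal{F}$ is a hereditary class if every graph isomorphic to an induced subgraph of a graph in $\mathcal{F}$ belongs to $\mathcal{F}$. For a hereditary class $\mathcal{F}$, the game $BS_n(\mathcal{F}:t_1,\dots,t_n)$ ($n$-Brussels sprout for $\mathcal{F}$ with parameters $(t_1,\dots,t_n)$) is the following two-player pen and paper game. It starts with $n$ spots having $t_1, \dots, t_n$ open tips (free partial edges coming out of the spot), respectively. The players move alternately. A valid move consists of joining two open tips with a curve, followed by drawing a crossbar on the curve to create two new open tips. The graph obtained by taking the spots and the intersections of a curve and a crossbar as vertices, and the curves joining two such vertices as edges, must remain inside the family $\mathcal{F}$ at all times. The first player unable to provide a valid move loses. The number of moves is the total number of moves made by both players.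
   Formalization: Every spot is required to have at least one open tip (each t_i ≥ 1) and n ≥ 1; with a spot without tips the claim fails, e.g. n = 2 and tips (0,1), where the game ends after 0 moves. -}

module Defs where

open import Data.Bool.Base using (if_then_else_)
open import Data.Fin.Base using (Fin; zero; suc; inject₁; fromℕ)
import Data.Fin.Properties as Fin
open import Data.List.Base using (List; []; _∷_; length; lookup; map)
open import Data.List.Membership.Propositional.Properties using (∈-lookup)
import Data.List.Relation.Unary.All as All
open import Data.List.Relation.Unary.AllPairs using (_∷_)
open import Data.List.Relation.Unary.Unique.Propositional using (Unique)
import Data.List.Relation.Unary.Unique.Propositional.Properties as Unique
import Data.List.Relation.Unary.Unique.DecPropositional as DecUnique
open import Data.Nat.Base using (ℕ; zero; suc; _+_; _∸_; _≤_; _<_; s≤s)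
import Data.Nat.Properties as ℕ
import Data.Product.Base as Product
open Product using (Σ; ∃; ∃₂; _×_; _,_; proj₁; proj₂)
open import Data.Product.Properties using (≡-dec)
open import Data.Rational.Base as ℚ using (ℚ; 0ℚ; 1ℚ)
import Data.Sum.Base as Sum
open Sum using (_⊎_; inj₁; inj₂)
open import Function.Base using (_∘_)
open import Function.Definitions using (Injective)
open import Relation.Binary.Construct.Add.Supremum.NonStrict _≤_
  using (_≤⁺_; [_]; _≤⊤⁺)
open import Relation.Binary.PropositionalEquality
  using (_≡_; refl; sym; trans; cong; subst)
open import Relation.Nullary using (¬_; Dec; yes; no; contradiction)
open import Relation.Nullary.Construct.Add.Supremum using (_⁺; ⊤⁺; [_])
open import Relation.Nullary.Decidable using (map′; _×-dec_; _⊎-dec_; ⌊_⌋)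

------------------------------------------------------------------------
-- Finite graphs

-- Multigraphs: joining two tips of one spot s yields two parallel edges
-- between s and the new vertex, and these form a cycle of length 2.
-- The order of the two ends of an edge carries no meaning.

record Graph : Set where
  field
    #vertices : ℕ
    #edges    : ℕ
    ends      : Fin #edges → Fin #vertices × Fin #vertices

  Vertex : Set
  Vertex = Fin #vertices

  Edge : Set
  Edge = Fin #edges

  Joins : Edge → Vertex → Vertex → Set
  Joins e u v = ends e ≡ (u , v) ⊎ ends e ≡ (v , u)

open Graph public using (Vertex; Edge; Joins; #vertices; #edges; ends)

-- An isomorphism from H onto the subgraph of G induced by the image of
-- `vertex`.

record InducedEmbedding (H G : Graph) : Set where
  field
    vertex           : Vertex H → Vertex G
    vertex-injective : Injective _≡_ _≡_ vertex
    edge             : Edge H → Edge G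
    edge-injective   : Injective _≡_ _≡_ edge
    preserves        : ∀ {e u v} → Joins H e u v →
                       Joins G (edge e) (vertex u) (vertex v)
    induced          : ∀ {e u v} → Joins G e (vertex u) (vertex v) →
                       ∃ λ d → edge d ≡ e

record HereditaryClass : Set₁ where
  field
    Contains   : Graph → Set
    hereditary : ∀ {H G} → InducedEmbedding H G → Contains G → Contains H

open HereditaryClass public using (Contains)

------------------------------------------------------------------------
-- Girth

data Walk (G : Graph) : Vertex G → Vertex G → ℕ → Set where
  []   : ∀ {v} → Walk G v v 0
  step : ∀ {u x v k} (e : Edge G) → Joins G e u x → Walk G x v k →
         Walk G u v (suc k)

walkEdges : ∀ {G u v k} → Walk G u v k → List (Edge G)
walkEdges []           = []
walkEdges (step e _ w) = e ∷ walkEdges w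

-- The final vertex is left out: in a closed walk it is the initial one.
walkVertices : ∀ {G u v k} → Walk G u v k → List (Vertex G)
walkVertices []                   = []
walkVertices (step {u = u} _ _ w) = u ∷ walkVertices w

IsCycle : ∀ {G v k} → Walk G v v k → Set
IsCycle {k = k} w = 0 < k × Unique (walkEdges w) × Unique (walkVertices w)

Cycle : Graph → ℕ → Set
Cycle G k = ∃ λ v → Σ (Walk G v v k) IsCycle

data IsGirth (G : Graph) : ℕ ⁺ → Set where
  finite   : ∀ {k} → Cycle G k → (∀ {l} → Cycle G l → k ≤ l) → IsGirth G [ k ]
  infinite : (∀ {l} → ¬ Cycle G l) → IsGirth G ⊤⁺

-- The girth exists constructively: a cycle has at most #edges edges, and
-- having a cycle of a given length is decidable.

private
  lookup-injective : {A : Set} {xs : List A} → Unique xs →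
                     Injective _≡_ _≡_ (lookup xs)
  lookup-injective (_ ∷ _)  {zero}  {zero}  _  = refl
  lookup-injective (px ∷ _) {zero}  {suc j} eq =
    contradiction eq (All.lookup px (∈-lookup j))
  lookup-injective (px ∷ _) {suc i} {zero}  eq =
    contradiction (sym eq) (All.lookup px (∈-lookup i))
  lookup-injective (_ ∷ u)  {suc i} {suc j} eq = cong suc (lookup-injective u eq)

  length-walkEdges : ∀ {G u v k} (w : Walk G u v k) → length (walkEdges w) ≡ k
  length-walkEdges []           = refl
  length-walkEdges (step _ _ w) = cong suc (length-walkEdges w)

  cycle≤#edges : ∀ {G k} → Cycle G k → k ≤ #edges G
  cycle≤#edges (_ , w , _ , unique , _) =
    subst (_≤ _) (length-walkEdges w) (Fin.injective⇒≤ (lookup-injective unique))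

  searchEquality : ∀ {n} {x y : Fin n × Fin n} (P : x ≡ y → Set) →
                   (∀ eq → Dec (P eq)) → Dec (∃ P)
  searchEquality {x = x} {y} P P? with ≡-dec Fin._≟_ Fin._≟_ x y
  ... | yes refl = map′ (refl ,_) (λ { (refl , h) → h }) (P? refl)
  ... | no x≢y   = no (x≢y ∘ proj₁)

  module _ (G : Graph) where

    searchJoins : ∀ {e u v} (P : Joins G e u v → Set) → (∀ j → Dec (P j)) → Dec (∃ P)
    searchJoins P P? = map′
      Sum.[ (λ (p , h) → inj₁ p , h) , (λ (q , h) → inj₂ q , h) ]
      (λ { (inj₁ p , h) → inj₁ (p , h) ; (inj₂ q , h) → inj₂ (q , h) })
      (searchEquality (P ∘ inj₁) (P? ∘ inj₁) ⊎-dec searchEquality (P ∘ inj₂) (P? ∘ inj₂))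

    searchWalk : ∀ {u v} k (P : Walk G u v k → Set) → (∀ w → Dec (P w)) → Dec (∃ P)
    searchWalk {u} {v} zero P P? with u Fin.≟ v
    ... | yes refl = map′ ([] ,_) (λ { ([] , h) → h }) (P? [])
    ... | no u≢v   = no λ { ([] , _) → u≢v refl }
    searchWalk (suc k) P P? = map′
      (λ { (e , x , j , w , h) → step e j w , h })
      (λ { (step e j w , h) → e , _ , j , w , h })
      (Fin.any? λ e → Fin.any? λ x →
       searchJoins (λ j → ∃ λ w → P (step {x = x} e j w)) λ j →
       searchWalk k (λ w → P (step e j w)) λ w → P? (step e j w))

    cycle? : ∀ k → Dec (Cycle G k)
    cycle? k = Fin.any? λ v → searchWalk k IsCycle λ w →
      (0 ℕ.<? k) ×-dec (DecUnique.unique? Fin._≟_ _ ×-dec DecUnique.unique? Fin._≟_ _)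

    shortestBelow : ∀ m → (∃ λ k → Cycle G k × (∀ {l} → Cycle G l → k ≤ l)) ⊎
                          (∀ {l} → l < m → ¬ Cycle G l)
    shortestBelow zero = inj₂ λ ()
    shortestBelow (suc m) with shortestBelow m
    ... | inj₁ found = inj₁ found
    ... | inj₂ none with cycle? m
    ...   | yes c = inj₁ (m , c , λ d → ℕ.≮⇒≥ λ l<m → none l<m d)
    ...   | no ¬c = inj₂ λ l<1+m d → Sum.[ (λ l<m → none l<m d) , (λ { refl → ¬c d }) ]
                                       (ℕ.m<1+n⇒m<n∨m≡n l<1+m)

  findGirth : ∀ G → ∃ (IsGirth G)
  findGirth G with shortestBelow G (suc (#edges G))
  ... | inj₁ (k , c , least) = [ k ] , finite c least
  ... | inj₂ none            = ⊤⁺ , infinite λ c → none (s≤s (cycle≤#edges c)) c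

girth : Graph → ℕ ⁺
girth G = proj₁ (findGirth G)

girth-isGirth : ∀ G → IsGirth G (girth G)
girth-isGirth G = proj₂ (findGirth G)

------------------------------------------------------------------------
-- Planarity

Point : Set
Point = ℚ × ℚ

-- The point a + s (b - a).
between : ℚ → Point → Point → Point
between s (a₁ , a₂) (b₁ , b₂) = mix a₁ b₁ , mix a₂ b₂
  where
  mix : ℚ → ℚ → ℚ
  mix a b = (1ℚ ℚ.- s) ℚ.* a ℚ.+ s ℚ.* b

-- The points of the topological realisation of G when edge e is cut by
-- `bends e` interior points into consecutive open segments.

data Locus (G : Graph) (bends : Edge G → ℕ) : Set where
  vertex : Vertex G → Locus G bends
  bend   : (e : Edge G) → Fin (bends e) → Locus G bends
  inner  : (e : Edge G) → Fin (suc (bends e)) →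
           (s : ℚ) → .(0ℚ ℚ.< s) → .(s ℚ.< 1ℚ) → Locus G bends

locate : ∀ {G bends} → (Vertex G → Point) → ((e : Edge G) → Fin (2 + bends e) → Point) →
         Locus G bends → Point
locate position knot (vertex v)        = position v
locate position knot (bend e j)        = knot e (suc (inject₁ j))
locate position knot (inner e i s _ _) = between s (knot e (inject₁ i)) (knot e (suc i))

-- A drawing without crossings: each edge is a polygonal arc between its
-- ends, and the whole realisation of G is mapped injectively to the plane.
-- Rational coordinates are enough: a real polygonal drawing can be
-- perturbed to a rational one, and rational segments that meet in the
-- real plane also meet in a rational point.

record PlaneDrawing (G : Graph) : Set where
  field
    position    : Vertex G → Point
    bends       : Edge G → ℕ
    knot        : (e : Edge G) → Fin (2 + bends e) → Point
    attached    : ∀ e → ∃₂ λ u v → Joins G e u v ×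
                  knot e zero ≡ position u ×
                  knot e (fromℕ (suc (bends e))) ≡ position v
    noncrossing : Injective _≡_ _≡_ (locate {G} position knot)

Planar : Graph → Set
Planar = PlaneDrawing

------------------------------------------------------------------------
-- The class of planar graphs of girth at least g

private
  module _ {H G : Graph} (ι : InducedEmbedding H G) where
    open InducedEmbedding ι renaming (vertex to f; edge to h)

    mapWalk : ∀ {u v k} → Walk H u v k → Walk G (f u) (f v) k
    mapWalk []           = []
    mapWalk (step e j w) = step (h e) (preserves j) (mapWalk w)

    walkEdges-map : ∀ {u v k} (w : Walk H u v k) →
                    walkEdges (mapWalk w) ≡ map h (walkEdges w)
    walkEdges-map []           = refl
    walkEdges-map (step e _ w) = cong (h e ∷_) (walkEdges-map w)

    walkVertices-map : ∀ {u v k} (w : Walk H u v k) →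
                       walkVertices (mapWalk w) ≡ map f (walkVertices w)
    walkVertices-map []           = refl
    walkVertices-map (step _ _ w) = cong (f _ ∷_) (walkVertices-map w)

    mapCycle : ∀ {k} → Cycle H k → Cycle G k
    mapCycle (v , w , 0<k , ue , uv) = f v , mapWalk w , 0<k ,
      subst Unique (sym (walkEdges-map w)) (Unique.map⁺ edge-injective ue) ,
      subst Unique (sym (walkVertices-map w)) (Unique.map⁺ vertex-injective uv)

    girth-hereditary : ∀ {g γ δ} → IsGirth G γ → IsGirth H δ →
                       [ g ] ≤⁺ γ → [ g ] ≤⁺ δ
    girth-hereditary _               (infinite _)  _       = _ ≤⊤⁺
    girth-hereditary (finite _ least) (finite c _) [ g≤k ] =
      [ ℕ.≤-trans g≤k (least (mapCycle c)) ]
    girth-hereditary (infinite none) (finite c _)  _       =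
      contradiction (mapCycle c) none

    planar-hereditary : Planar G → Planar H
    planar-hereditary D = record
      { position    = D.position ∘ f
      ; bends       = D.bends ∘ h
      ; knot        = λ e → D.knot (h e)
      ; attached    = attached
      ; noncrossing = λ {x} {y} eq → mapLocus-injective x y
          (D.noncrossing (trans (locate-map x) (trans eq (sym (locate-map y)))))
      }
      where
      module D = PlaneDrawing D

      position′ : Vertex H → Point
      position′ = D.position ∘ f

      attached : ∀ e → ∃₂ λ u v → Joins H e u v ×
                 D.knot (h e) zero ≡ position′ u ×
                 D.knot (h e) (fromℕ (suc (D.bends (h e)))) ≡ position′ v
      attached e with ends H e in eq | D.attached (h e)
      ... | a , b | u , v , j , first , last with preserves {e} {a} {b} (inj₁ eq) | j
      ... | inj₁ p | inj₁ q with refl ← trans (sym p) q = a , b , inj₁ refl , first , last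
      ... | inj₁ p | inj₂ q with refl ← trans (sym p) q = b , a , inj₂ refl , first , last
      ... | inj₂ p | inj₁ q with refl ← trans (sym p) q = b , a , inj₂ refl , first , last
      ... | inj₂ p | inj₂ q with refl ← trans (sym p) q = a , b , inj₁ refl , first , last

      mapLocus : Locus H (D.bends ∘ h) → Locus G D.bends
      mapLocus (vertex v)        = vertex (f v)
      mapLocus (bend e j)        = bend (h e) j
      mapLocus (inner e i s p q) = inner (h e) i s p q

      locate-map : ∀ x → locate D.position D.knot (mapLocus x) ≡
                   locate {H} position′ (λ e → D.knot (h e)) x
      locate-map (vertex _)        = refl
      locate-map (bend _ _)        = refl
      locate-map (inner _ _ _ _ _) = refl

      vertex-injective′ : ∀ {u v} → vertex {G} {D.bends} u ≡ vertex v → u ≡ v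
      vertex-injective′ refl = refl

      bend-injective : ∀ {d e j k} → bend {G} {D.bends} d j ≡ bend e k →
                       _≡_ {A = Σ (Edge G) (Fin ∘ D.bends)} (d , j) (e , k)
      bend-injective refl = refl

      inner-injective : ∀ {d e i j s t} .{p q p′ q′} →
                        inner {G} {D.bends} d i s p q ≡ inner e j t p′ q′ →
                        _≡_ {A = Σ (Edge G) λ e → Fin (suc (D.bends e)) × ℚ}
                            (d , i , s) (e , j , t)
      inner-injective refl = refl

      mapLocus-injective : ∀ x y → mapLocus x ≡ mapLocus y → x ≡ y
      mapLocus-injective (vertex u) (vertex v) eq =
        cong vertex (vertex-injective (vertex-injective′ eq))
      mapLocus-injective (bend d j) (bend e k) eq
        with eq′ ← bend-injective eq
        with refl ← edge-injective (cong proj₁ eq′)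
        with refl ← eq′ = refl
      mapLocus-injective (inner d i s _ _) (inner e j t _ _) eq
        with eq′ ← inner-injective eq
        with refl ← edge-injective (cong proj₁ eq′)
        with refl ← eq′ = refl
      mapLocus-injective (vertex _) (bend _ _) ()
      mapLocus-injective (vertex _) (inner _ _ _ _ _) ()
      mapLocus-injective (bend _ _) (vertex _) ()
      mapLocus-injective (bend _ _) (inner _ _ _ _ _) ()
      mapLocus-injective (inner _ _ _ _ _) (vertex _) ()
      mapLocus-injective (inner _ _ _ _ _) (bend _ _) ()

𝒫 : ℕ → HereditaryClass
𝒫 g = record
  { Contains   = λ G → Planar G × [ g ] ≤⁺ girth G
  ; hereditary = λ {H} {G} ι (planar , g≤girth) →
      planar-hereditary ι planar ,
      girth-hereditary ι (girth-isGirth G) (girth-isGirth H) g≤girth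
  }

------------------------------------------------------------------------
-- The game

-- A two-player game in which both players have the same moves; who is to
-- move has no bearing on the length of a play.

record Game : Set₁ where
  infix 4 _⟶_
  field
    Position : Set
    start    : Position
    _⟶_      : Position → Position → Set

module _ (Γ : Game) where
  open Game Γ

  EndsAfterFrom : ℕ → Position → Set
  EndsAfterFrom zero    p = ∀ {q} → ¬ p ⟶ q
  EndsAfterFrom (suc k) p = ∃ (p ⟶_) × (∀ {q} → p ⟶ q → EndsAfterFrom k q)

  -- Every maximal play consists of exactly k moves.
  EndsExactlyAfter : ℕ → Set
  EndsExactlyAfter k = EndsAfterFrom k start

record Configuration : Set where
  field
    graph : Graph
    tips  : Vertex graph → ℕ

open Configuration public

-- How many tips of w are used up by joining a tip of u to a tip of v
-- (two if u, v and w coincide).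
tipsUsed : ∀ {n} → Fin n → Fin n → Fin n → ℕ
tipsUsed u v w = δ u + δ v
  where
  δ : Fin _ → ℕ
  δ x = if ⌊ x Fin.≟ w ⌋ then 1 else 0

-- The new vertex `zero`, where the crossbar meets the curve from u to v,
-- splits that curve into the edges `zero` and `suc zero`.
joinVertices : (G : Graph) → Vertex G → Vertex G → Graph
joinVertices G u v = record
  { #vertices = 1 + #vertices G ; #edges = 2 + #edges G ; ends = ends′ }
  where
  ends′ : Fin (2 + #edges G) → Fin (1 + #vertices G) × Fin (1 + #vertices G)
  ends′ zero          = suc u , zero
  ends′ (suc zero)    = zero , suc v
  ends′ (suc (suc e)) = Product.map suc suc (ends G e)

joinTips : (p : Configuration) → Vertex (graph p) → Vertex (graph p) → Configuration
joinTips p u v = record { graph = joinVertices (graph p) u v ; tips = tips′ }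
  where
  tips′ : Fin (1 + #vertices (graph p)) → ℕ
  tips′ zero    = 2
  tips′ (suc w) = tips p w ∸ tipsUsed u v w

data Move (F : HereditaryClass) (p : Configuration) : Configuration → Set where
  move : ∀ u v → (∀ w → tipsUsed u v w ≤ tips p w) →
         Contains F (graph (joinTips p u v)) → Move F p (joinTips p u v)

-- The n-Brussels sprout game for F with parameters t.
BS : (n : ℕ) → HereditaryClass → (Fin n → ℕ) → Game
BS n F t = record
  { Position = Configuration
  ; start    = record
      { graph = record { #vertices = n ; #edges = 0 ; ends = λ () }
      ; tips  = t
      }
  ; _⟶_      = Move F
  }

{-# OPTIONS --safe #-}

-- Every position is a forest each of whose trees carries an open tip. After m
-- moves it has n + m vertices and n - m trees. Joining two tips of one tree would
-- close a cycle through at most n + m + 1 ≤ 2n < g vertices, so every move joins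
-- two trees; conversely any two trees can be joined, since the result is again a
-- forest, which has no cycle and is planar. The plane drawing roots each tree, puts
-- a vertex at height its depth, and orders each level lexicographically by the
-- way down from the root.

module Submission where

open import Defs
open import Data.Bool.Base using (Bool; true; false)
import Data.Bool.Properties as Bool
open import Data.Fin.Base using (Fin; zero; suc; toℕ; punchOut; punchIn)
import Data.Fin.Properties as Fin
open import Data.List.Base using (List; []; _∷_; length; lookup; map)
open import Data.List.Membership.Propositional using (_∈_; _∉_)
open import Data.List.Membership.Propositional.Properties using (∈-lookup)
import Data.List.Membership.DecPropositional as DecMembership
open import Data.List.Relation.Unary.All as All using (All; []; _∷_)
import Data.List.Relation.Unary.All.Properties as All
open import Data.List.Relation.Unary.AllPairs using ([]; _∷_)
open import Data.List.Relation.Unary.Any using (here; there)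
open import Data.List.Relation.Unary.Unique.Propositional using (Unique)
import Data.List.Relation.Unary.Unique.Propositional.Properties as Unique
open import Data.Nat.Base using (ℕ; zero; suc; NonZero; _+_; _*_; _∸_; _≤_; _<_; _≥_; z≤n; s≤s)
import Data.Nat.Properties as ℕ
import Data.Nat.Tactic.RingSolver as ℕ-Solver
import Data.Product.Base as Product
open Product using (Σ; ∃; _×_; _,_; proj₁; proj₂)
open import Data.Rational.Base as ℚ using (ℚ; 0ℚ; 1ℚ)
import Data.Rational.Properties as ℚ
open import Data.Rational.Solver using (module +-*-Solver)
import Data.Sum.Base as Sum
open Sum using (_⊎_; inj₁; inj₂; [_,_]′)
open import Function.Base using (_∘_; id)
open import Function.Definitions using (Injective)
open import Relation.Binary.Construct.Add.Supremum.NonStrict _≤_ using (_≤⁺_; [_]; _≤⊤⁺)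
open import Relation.Binary.Definitions using (DecidableEquality)
open import Relation.Binary.PropositionalEquality
  using (_≡_; _≢_; refl; sym; trans; cong; cong₂; subst; subst₂; ≢-sym; module ≡-Reasoning)
open import Relation.Nullary using (¬_; yes; no; contradiction)
open import Relation.Nullary.Construct.Add.Supremum using ([_])
open import Relation.Nullary.Decidable using (recompute)

-- Walks and paths

Joins-unique : ∀ G {e : Edge G} {a b x y} → Joins G e a b → Joins G e x y →
               (a ≡ x × b ≡ y) ⊎ (a ≡ y × b ≡ x)
Joins-unique _ (inj₁ p) (inj₁ q) with refl ← trans (sym p) q = inj₁ (refl , refl)
Joins-unique _ (inj₁ p) (inj₂ q) with refl ← trans (sym p) q = inj₂ (refl , refl)
Joins-unique _ (inj₂ p) (inj₁ q) with refl ← trans (sym p) q = inj₂ (refl , refl)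
Joins-unique _ (inj₂ p) (inj₂ q) with refl ← trans (sym p) q = inj₁ (refl , refl)

lookup-injective : {A : Set} {xs : List A} → Unique xs → Injective _≡_ _≡_ (lookup xs)
lookup-injective (_ ∷ _)  {zero}  {zero}  _  = refl
lookup-injective (px ∷ _) {zero}  {suc j} eq = contradiction eq (All.lookup px (∈-lookup j))
lookup-injective (px ∷ _) {suc i} {zero}  eq = contradiction (sym eq) (All.lookup px (∈-lookup i))
lookup-injective (_ ∷ u)  {suc i} {suc j} eq = cong suc (lookup-injective u eq)

unique⇒length≤ : ∀ {n} {xs : List (Fin n)} → Unique xs → length xs ≤ n
unique⇒length≤ u = Fin.injective⇒≤ (lookup-injective u)

module _ {G : Graph} where

  length-walkVertices : ∀ {u v k} (w : Walk G u v k) → length (walkVertices w) ≡ k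
  length-walkVertices []           = refl
  length-walkVertices (step _ _ w) = cong suc (length-walkVertices w)

  infixr 5 _++ʷ_
  _++ʷ_ : ∀ {u v x k l} → Walk G u v k → Walk G v x l → Walk G u x (k + l)
  []         ++ʷ w′ = w′
  step e j w ++ʷ w′ = step e j (w ++ʷ w′)

  -- The final vertex, which `walkVertices` leaves out, is put in front: this is the order in which
  -- `path⇒cycle` meets the vertices.
  visited : ∀ {u v k} → Walk G u v k → List (Vertex G)
  visited {v = v} w = v ∷ walkVertices w

  IsPath : ∀ {u v k} → Walk G u v k → Set
  IsPath w = Unique (walkEdges w) × Unique (visited w)

  Path : Vertex G → Vertex G → Set
  Path u v = ∃ λ k → Σ (Walk G u v k) IsPath

  start∈visited : ∀ {u v k} (w : Walk G u v k) → u ∈ visited w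
  start∈visited []           = here refl
  start∈visited (step _ _ _) = there (here refl)

  visited-step : ∀ {u x v k a} e (j : Joins G e u x) (w : Walk G x v k) →
                 a ∈ visited w → a ∈ visited (step e j w)
  visited-step _ _ _ (here refl) = here refl
  visited-step _ _ _ (there a∈w) = there (there a∈w)

  -- Serves to show that an edge at an unvisited vertex is new to the walk, so that prepending it
  -- keeps the edges distinct.
  incident∈visited : ∀ {u v k e a b} (w : Walk G u v k) →
                     Joins G e a b → e ∈ walkEdges w → a ∈ visited w
  incident∈visited (step e j w) j′ (here refl) with Joins-unique G j′ j
  ... | inj₁ (refl , _) = there (here refl)
  ... | inj₂ (refl , _) = visited-step e j w (start∈visited w)
  incident∈visited (step e j w) j′ (there e∈w) =
    visited-step e j w (incident∈visited w j′ e∈w)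

  suffix : ∀ {u v k x} (w : Walk G u v k) → IsPath w → x ∈ walkVertices w → Path x v
  suffix w@(step _ _ _) p (here refl) = _ , w , p
  suffix (step _ _ w) (_ ∷ ue , (_ ∷ v∉) ∷ (_ ∷ uv)) (there x∈w) =
    suffix w (ue , v∉ ∷ uv) x∈w

  -- Loop erasure: if the path found for the tail already meets `u`, its part from `u` on is kept;
  -- otherwise the step is prepended.
  walk⇒path : ∀ {u v k} → Walk G u v k → Path u v
  walk⇒path [] = 0 , [] , [] , [] ∷ []
  walk⇒path {u} {v} (step e j w) with walk⇒path w
  ... | k , w′ , ue , v∉ ∷ uv with u Fin.≟ v | u ∈? walkVertices w′
    where open DecMembership Fin._≟_ using (_∈?_)
  ...   | yes refl | _       = 0 , [] , [] , [] ∷ []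
  ...   | no _     | yes u∈w = suffix w′ (ue , v∉ ∷ uv) u∈w
  ...   | no u≢v   | no u∉w  = suc k , step e j w′ ,
    All.¬Any⇒All¬ _ (u∉visited ∘ incident∈visited w′ j) ∷ ue ,
    (≢-sym u≢v ∷ v∉) ∷ All.¬Any⇒All¬ _ u∉w ∷ uv
    where
    u∉visited : u ∉ visited w′
    u∉visited (here u≡v)  = u≢v u≡v
    u∉visited (there u∈w) = u∉w u∈w

-- Rooted forests

-- Each edge is identified by its lower end. Injectivity of `child` leaves every vertex at most one
-- edge upwards; together with the depths this excludes cycles.
record Rooting (G : Graph) : Set where
  field
    -- The value of up at a root is junk.
    up              : Vertex G → Vertex G
    child           : Edge G → Vertex G
    depth           : Vertex G → ℕ
    child-injective : Injective _≡_ _≡_ child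
    joins           : ∀ e → Joins G e (up (child e)) (child e)
    depth-child     : ∀ e → depth (child e) ≡ suc (depth (up (child e)))

  parent : Edge G → Vertex G
  parent = up ∘ child

open Rooting using (depth)

module _ {G : Graph} (R : Rooting G) where
  open Rooting R hiding (depth)

  ascend⊎descend : ∀ {e x y} → Joins G e x y →
    (child e ≡ x × depth R x ≡ suc (depth R y)) ⊎ (child e ≡ y × depth R y ≡ suc (depth R x))
  ascend⊎descend {e} j with Joins-unique G (joins e) j
  ... | inj₁ (refl , refl) = inj₂ (refl , depth-child e)
  ... | inj₂ (refl , refl) = inj₁ (refl , depth-child e)

  -- After a descent the only way up is back along the same edge.
  descending : ∀ {e x v k} (w : Walk G x v k) → child e ≡ x → Unique (e ∷ walkEdges w) →
               depth R x ≤ depth R v × ∃ λ d → d ∈ e ∷ walkEdges w × child d ≡ v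
  descending []           ce u = ℕ.≤-refl , _ , here refl , ce
  descending (step d j w) ce ((e≢d ∷ _) ∷ u) with ascend⊎descend j
  ... | inj₁ (cd , _)  = contradiction (child-injective (trans ce (sym cd))) e≢d
  ... | inj₂ (cd , eq) with descending w cd u
  ...   | y≤v , d′ , d′∈w , cd′ =
    ℕ.≤-trans (ℕ.<⇒≤ (ℕ.≤-reflexive (sym eq))) y≤v , d′ , there d′∈w , cd′

  -- By `descending`, a walk without repeated edges first ascends and then only descends. Either it
  -- never descends, or it arrives at `v` from the parent of `v`.
  ascending⊎ends-descending : ∀ {u v k} (w : Walk G u v k) → Unique (walkEdges w) →
    depth R v ≤ depth R u ⊎ ∃ λ d → d ∈ walkEdges w × child d ≡ v
  ascending⊎ends-descending [] _ = inj₁ ℕ.≤-refl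
  ascending⊎ends-descending (step e j w) (e∉ ∷ u) with ascend⊎descend j
  ... | inj₂ (ce , _)  = inj₂ (proj₂ (descending w ce (e∉ ∷ u)))
  ... | inj₁ (_ , eq) with ascending⊎ends-descending w u
  ...   | inj₁ v≤y           = inj₁ (ℕ.≤-trans v≤y (ℕ.<⇒≤ (ℕ.≤-reflexive (sym eq))))
  ...   | inj₂ (d , d∈ , cd) = inj₂ (d , there d∈ , cd)

  -- A cycle that starts downwards would end below its start. One that starts upwards must come back
  -- down to its start, through the only edge having it as child, which is the edge it left by.
  rooting⇒acyclic : ∀ {l} → ¬ Cycle G l
  rooting⇒acyclic (v , [] , () , _)
  rooting⇒acyclic (v , step e j w , _ , e∉ ∷ u , _) with ascend⊎descend j
  ... | inj₂ (ce , eq) = ℕ.<⇒≱ (ℕ.≤-reflexive (sym eq)) (proj₁ (descending w ce (e∉ ∷ u)))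
  ... | inj₁ (ce , eq) with ascending⊎ends-descending w u
  ...   | inj₁ v≤x           = ℕ.<⇒≱ (ℕ.≤-reflexive (sym eq)) v≤x
  ...   | inj₂ (d , d∈ , cd) = All.lookup e∉ d∈ (child-injective (trans ce (sym cd)))

-- Straight-line drawings of rooted forests

fromℕ : ℕ → ℚ
fromℕ zero    = 0ℚ
fromℕ (suc n) = 1ℚ ℚ.+ fromℕ n

fromℕ-<suc : ∀ n → fromℕ n ℚ.< fromℕ (suc n)
fromℕ-<suc n = subst (ℚ._< fromℕ (suc n)) (ℚ.+-identityˡ (fromℕ n))
  (ℚ.+-monoˡ-< (fromℕ n) (ℚ.positive⁻¹ 1ℚ))

fromℕ-mono-≤ : ∀ {m n} → m ≤ n → fromℕ m ℚ.≤ fromℕ n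
fromℕ-mono-≤ {n = zero}  z≤n       = ℚ.≤-refl
fromℕ-mono-≤ {n = suc n} z≤n       =
  ℚ.≤-trans (fromℕ-mono-≤ (z≤n {n})) (ℚ.<⇒≤ (fromℕ-<suc n))
fromℕ-mono-≤             (s≤s m≤n) = ℚ.+-monoʳ-≤ 1ℚ (fromℕ-mono-≤ m≤n)

fromℕ-mono-< : ∀ {m n} → m < n → fromℕ m ℚ.< fromℕ n
fromℕ-mono-< {m} m<n = ℚ.<-≤-trans (fromℕ-<suc m) (fromℕ-mono-≤ m<n)

integerPart-≤ : ∀ m n {s t} → fromℕ m ℚ.+ s ≡ fromℕ n ℚ.+ t → 0ℚ ℚ.≤ s → t ℚ.< 1ℚ → m ≤ n
integerPart-≤ m n {s} {t} eq 0≤s t<1 = ℕ.≮⇒≥ λ n<m → ℚ.<-irrefl (sym eq) (begin-strict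
  fromℕ n ℚ.+ t  <⟨ ℚ.+-monoʳ-< (fromℕ n) t<1 ⟩
  fromℕ n ℚ.+ 1ℚ ≡⟨ ℚ.+-comm (fromℕ n) 1ℚ ⟩
  fromℕ (suc n)  ≤⟨ fromℕ-mono-≤ n<m ⟩
  fromℕ m        ≡⟨ ℚ.+-identityʳ (fromℕ m) ⟨
  fromℕ m ℚ.+ 0ℚ ≤⟨ ℚ.+-monoʳ-≤ (fromℕ m) 0≤s ⟩
  fromℕ m ℚ.+ s  ∎)
  where open ℚ.≤-Reasoning

-- Serves to read off heights: the height of a point on an edge determines both the level of the
-- parent and the parameter along the segment.
integerPart-unique : ∀ m n {s t} → fromℕ m ℚ.+ s ≡ fromℕ n ℚ.+ t →
  0ℚ ℚ.≤ s → s ℚ.< 1ℚ → 0ℚ ℚ.≤ t → t ℚ.< 1ℚ → m ≡ n × s ≡ t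
integerPart-unique m n eq 0≤s s<1 0≤t t<1
  with refl ← ℕ.≤-antisym (integerPart-≤ m n eq 0≤s t<1) (integerPart-≤ n m (sym eq) 0≤t s<1) =
  refl , +-cancelˡ (fromℕ m) eq
  where
  +-cancelˡ : ∀ p {q r} → p ℚ.+ q ≡ p ℚ.+ r → q ≡ r
  +-cancelˡ p {q} {r} eq = trans (sym (undo q)) (trans (cong (ℚ.- p ℚ.+_) eq) (undo r))
    where
    undo : ∀ q → ℚ.- p ℚ.+ (p ℚ.+ q) ≡ q
    undo = solve 2 (λ p q → :- p :+ (p :+ q) := q) refl p
      where open +-*-Solver

fromℕ-injective : ∀ {m n} → fromℕ m ≡ fromℕ n → m ≡ n
fromℕ-injective {m} {n} eq = proj₁ (integerPart-unique m n (cong (ℚ._+ 0ℚ) eq)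
  ℚ.≤-refl (ℚ.positive⁻¹ 1ℚ) ℚ.≤-refl (ℚ.positive⁻¹ 1ℚ))

leadingDigit-≤ : ∀ {N} a b (i j : Fin N) → a * N + toℕ i ≤ b * N + toℕ j → a ≤ b
leadingDigit-≤ {N} a b i j ≤ = ℕ.≮⇒≥ λ b<a → ℕ.<⇒≱ (begin-strict
  b * N + toℕ j <⟨ ℕ.+-monoʳ-< (b * N) (Fin.toℕ<n j) ⟩
  b * N + N     ≡⟨ ℕ.+-comm (b * N) N ⟩
  suc b * N     ≤⟨ ℕ.*-monoˡ-≤ N b<a ⟩
  a * N         ≤⟨ ℕ.m≤m+n (a * N) (toℕ i) ⟩
  a * N + toℕ i ∎) ≤
  where open ℕ.≤-Reasoning

lastDigit-unique : ∀ {N} a b (i j : Fin N) → a * N + toℕ i ≡ b * N + toℕ j → i ≡ j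
lastDigit-unique a b i j eq
  with refl ← ℕ.≤-antisym (leadingDigit-≤ a b i j (ℕ.≤-reflexive eq))
                          (leadingDigit-≤ b a j i (ℕ.≤-reflexive (sym eq))) =
  Fin.toℕ-injective (ℕ.+-cancelˡ-≡ _ _ _ eq)

-- The first coordinate of `between s`.
mix : ℚ → ℚ → ℚ → ℚ
mix s p q = proj₁ (between s (p , p) (q , q))

mix-suc : ∀ s n → mix s (fromℕ n) (fromℕ (suc n)) ≡ fromℕ n ℚ.+ s
mix-suc s n = solve 2 (λ s p → (con 1ℚ :- s) :* p :+ s :* (con 1ℚ :+ p) := p :+ s) refl s (fromℕ n)
  where open +-*-Solver

mix-mono-< : ∀ {s p p′ q q′} → 0ℚ ℚ.< s → s ℚ.< 1ℚ → p ℚ.≤ p′ → q ℚ.< q′ →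
             mix s p q ℚ.< mix s p′ q′
mix-mono-< {s} 0<s s<1 p≤p′ q<q′ = ℚ.+-mono-≤-<
  (ℚ.*-monoˡ-≤-nonNeg (1ℚ ℚ.- s) {{ℚ.nonNegative 0≤1-s}} p≤p′)
  (ℚ.*-monoʳ-<-pos s {{ℚ.positive 0<s}} q<q′)
  where
  0≤1-s : 0ℚ ℚ.≤ 1ℚ ℚ.- s
  0≤1-s = subst (ℚ._≤ 1ℚ ℚ.- s) (ℚ.+-inverseʳ s) (ℚ.+-monoˡ-≤ (ℚ.- s) (ℚ.<⇒≤ s<1))

module _ {G : Graph} (R : Rooting G) where
  open Rooting R hiding (depth)

  private
    N = #vertices G

    -- The number counts the steps up still to be taken and makes the recursion structural; `prefix`
    -- omits the last digit.
    prefix : ℕ → Vertex G → ℕ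
    column : ℕ → Vertex G → ℕ
    prefix zero    _ = 0
    prefix (suc d) v = column d (up v)
    column d v = prefix d v * N + toℕ v

  -- The vertices on the way from the root to v, read as digits in base N,
  -- so that every level is ordered lexicographically.
  abscissa : Vertex G → ℕ
  abscissa v = column (depth R v) v

  -- The last digit is the vertex itself.
  abscissa-injective : ∀ {u v} → abscissa u ≡ abscissa v → u ≡ v
  abscissa-injective = lastDigit-unique (prefix (depth R _) _) (prefix (depth R _) _) _ _

  abscissa-child : ∀ e → abscissa (child e) ≡ abscissa (parent e) * N + toℕ (child e)
  abscissa-child e = cong (λ d → column d (child e)) (depth-child e)

  -- Parents supply the leading digits of their children. Hence children never reverse the order of
  -- their parents, and segments between the same two levels do not cross.
  abscissa-parent-mono : ∀ d e → abscissa (child d) ≤ abscissa (child e) →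
                         abscissa (parent d) ≤ abscissa (parent e)
  abscissa-parent-mono d e ≤ = leadingDigit-≤ _ _ (child d) (child e)
    (subst₂ _≤_ (abscissa-child d) (abscissa-child e) ≤)

  rooting⇒planar : Planar G
  rooting⇒planar = record
    { position    = position
    ; bends       = bends
    ; knot        = knot
    ; attached    = λ e → parent e , child e , joins e , refl , refl
    ; noncrossing = λ {x} {y} → noncrossing x y
    }
    where
    position : Vertex G → Point
    position v = fromℕ (abscissa v) , fromℕ (depth R v)

    bends : Edge G → ℕ
    bends _ = 0

    knot : (e : Edge G) → Fin (2 + bends e) → Point
    knot e zero    = position (parent e)
    knot e (suc _) = position (child e)

    ordinate : ∀ e s → mix s (fromℕ (depth R (parent e))) (fromℕ (depth R (child e))) ≡
               fromℕ (depth R (parent e)) ℚ.+ s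
    ordinate e s rewrite depth-child e = mix-suc s (depth R (parent e))

    -- Vertices lie at integer heights, inner points of segments strictly between two consecutive
    -- ones.
    vertex≢inner : ∀ v e {s} → 0ℚ ℚ.< s → s ℚ.< 1ℚ →
      fromℕ (depth R v) ≢ mix s (fromℕ (depth R (parent e))) (fromℕ (depth R (child e)))
    vertex≢inner v e {s} 0<s s<1 eq = ℚ.<-irrefl
      (proj₂ (integerPart-unique (depth R v) (depth R (parent e))
        (trans (ℚ.+-identityʳ _) (trans eq (ordinate e s)))
        ℚ.≤-refl (ℚ.positive⁻¹ 1ℚ) (ℚ.<⇒≤ 0<s) s<1))
      0<s

    -- If the child of `d` were strictly to the left, its parent would be weakly to the left, and so
    -- the point at `s` strictly to the left.
    child-≤ : ∀ d e {s} → 0ℚ ℚ.< s → s ℚ.< 1ℚ →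
      mix s (fromℕ (abscissa (parent d))) (fromℕ (abscissa (child d))) ≡
      mix s (fromℕ (abscissa (parent e))) (fromℕ (abscissa (child e))) →
      abscissa (child e) ≤ abscissa (child d)
    child-≤ d e 0<s s<1 eq = ℕ.≮⇒≥ λ d<e → ℚ.<-irrefl eq
      (mix-mono-< 0<s s<1 (fromℕ-mono-≤ (abscissa-parent-mono d e (ℕ.<⇒≤ d<e))) (fromℕ-mono-< d<e))

    noncrossing : ∀ x y → locate {G} {bends} position knot x ≡ locate position knot y → x ≡ y
    noncrossing (vertex u) (vertex v) eq =
      cong vertex (abscissa-injective (fromℕ-injective (cong proj₁ eq)))
    -- The bounds on `s` are irrelevant in `inner`; deciding them again makes them usable.
    noncrossing (vertex v) (inner e zero s 0<s s<1) eq = contradiction (cong proj₂ eq)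
      (vertex≢inner v e (recompute (0ℚ ℚ.<? s) 0<s) (recompute (s ℚ.<? 1ℚ) s<1))
    noncrossing (inner e zero s 0<s s<1) (vertex v) eq = contradiction (sym (cong proj₂ eq))
      (vertex≢inner v e (recompute (0ℚ ℚ.<? s) 0<s) (recompute (s ℚ.<? 1ℚ) s<1))
    noncrossing (inner d zero s 0<s s<1) (inner e zero t 0<t t<1) eq
      with 0<s′ ← recompute (0ℚ ℚ.<? s) 0<s | s<1′ ← recompute (s ℚ.<? 1ℚ) s<1
      with _ , refl ← integerPart-unique (depth R (parent d)) (depth R (parent e))
             (trans (sym (ordinate d s)) (trans (cong proj₂ eq) (ordinate e t)))
             (ℚ.<⇒≤ 0<s′) s<1′ (ℚ.<⇒≤ (recompute (0ℚ ℚ.<? t) 0<t)) (recompute (t ℚ.<? 1ℚ) t<1)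
      with refl ← child-injective (abscissa-injective (ℕ.≤-antisym
             (child-≤ e d 0<s′ s<1′ (sym (cong proj₁ eq)))
             (child-≤ d e 0<s′ s<1′ (cong proj₁ eq)))) = refl

-- Membership in the class and cycle lengths

rooting⇒∈𝒫 : ∀ {G} g → Rooting G → Contains (𝒫 g) G
rooting⇒∈𝒫 {G} g R = rooting⇒planar R , bound (girth-isGirth G)
  where
  -- A variable `γ` in place of `girth G` permits matching on the girth, which is infinite for a
  -- forest.
  bound : ∀ {γ} → IsGirth G γ → [ g ] ≤⁺ γ
  bound (finite c _) = contradiction c (rooting⇒acyclic R)
  bound (infinite _) = _ ≤⊤⁺

g≤cycle : ∀ {G g l} → Contains (𝒫 g) G → Cycle G l → g ≤ l
g≤cycle {G} {g} (_ , g≤girth) c = bound (girth-isGirth G) g≤girth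
  where
  bound : ∀ {γ} → IsGirth G γ → [ g ] ≤⁺ γ → g ≤ _
  bound (finite _ least) [ g≤k ] = ℕ.≤-trans g≤k (least c)
  bound (infinite none)  _       = contradiction c none

-- Joining two trees

-- Depth 0 makes `r` a root, since children have positive depth. Every `r` is allowed because a tree
-- hung on a bridge must be rooted at its end of the bridge.
Rootable : Graph → Set
Rootable G = ∀ r → Σ (Rooting G) λ R → depth R r ≡ 0

graphOf : (m n : ℕ) → (Fin n → Fin m × Fin m) → Graph
graphOf m n ends = record { #vertices = m ; #edges = n ; ends = ends }

-- Rooting at the new vertex still takes some rooting of the old graph, which `v` provides.
isolatedVertex : ∀ {m n ends} → Fin m → Rootable (graphOf m n ends) →
                 Rootable (graphOf (suc m) n (Product.map suc suc ∘ ends))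
isolatedVertex {m} {n} {ends} v rootable =
  λ { zero    → extend (proj₁ (rootable v)) , refl
    ; (suc r) → extend (proj₁ (rootable r)) , proj₂ (rootable r) }
  where
  extend : Rooting (graphOf m n ends) → Rooting (graphOf (suc m) n (Product.map suc suc ∘ ends))
  extend R = record
    { up              = λ { zero → zero ; (suc x) → suc (R.up x) }
    ; child           = suc ∘ R.child
    ; depth           = λ { zero → 0 ; (suc x) → R.depth x }
    ; child-injective = R.child-injective ∘ Fin.suc-injective
    ; joins           = λ e → Sum.map (cong (Product.map suc suc)) (cong (Product.map suc suc)) (R.joins e)
    ; depth-child     = R.depth-child
    }
    where module R = Rooting R

-- The edge `zero` is added to the graph `G₀` of the other edges. As `side` is constant along those,
-- having ends on different sides makes `zero` a bridge.
module _ {m n} (ends : Fin (suc n) → Fin m × Fin m)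
         {A : Set} (_≟_ : DecidableEquality A) (side : Fin m → A)
         (side-ends : ∀ e → side (proj₁ (ends (suc e))) ≡ side (proj₂ (ends (suc e)))) where

  private
    G  = graphOf m (suc n) ends
    G₀ = graphOf m n (ends ∘ suc)

    edgeSide : Edge G₀ → A
    edgeSide e = side (proj₁ (ends (suc e)))

    side-joins : ∀ {e x y} → Joins G₀ e x y → side x ≡ edgeSide e × side y ≡ edgeSide e
    side-joins {e} (inj₁ p) with eq ← side-ends e rewrite p = refl , sym eq
    side-joins {e} (inj₂ p) with eq ← side-ends e rewrite p = sym eq , refl

  -- Use R s on side s, and hang the tree of b below a.
  module Hang {a b} (ab : Joins G zero a b) (a≢b : side a ≢ side b)
              (R : A → Rooting G₀) (b-root : depth (R (side b)) b ≡ 0) where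

    private module R s = Rooting (R s)

    child : Edge G → Vertex G
    child zero    = b
    child (suc e) = R.child (edgeSide e) e

    up : Vertex G → Vertex G
    up x with x Fin.≟ b
    ... | yes _ = a
    ... | no _  = R.up (side x) x

    -- Shifts the side of `b` so that its root `b` comes one level below `a`.
    offset : A → ℕ
    offset s with s ≟ side b
    ... | yes _ = suc (R.depth (side a) a)
    ... | no _  = 0

    depth′ : Vertex G → ℕ
    depth′ x = offset (side x) + R.depth (side x) x

    depth′-at : ∀ {x s} → side x ≡ s → depth′ x ≡ offset s + R.depth s x
    depth′-at refl = refl

    side-child : ∀ s e → side (R.child s e) ≡ edgeSide e
    side-child s e = proj₂ (side-joins (R.joins s e))

    side-parent : ∀ s e → side (R.parent s e) ≡ edgeSide e
    side-parent s e = proj₁ (side-joins (R.joins s e))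

    -- A child has positive depth, but `b` is a root on its side. So `b` is free to become the child
    -- of the new edge.
    child≢b : ∀ e → R.child (edgeSide e) e ≢ b
    child≢b e eq with trans (sym b-root)
      (subst (λ x → R.depth (side x) x ≡ suc (R.depth (side x) (R.up (side x) x))) eq depth-child)
      where
      depth-child : R.depth (side (R.child (edgeSide e) e)) (R.child (edgeSide e) e) ≡
        suc (R.depth (side (R.child (edgeSide e) e))
              (R.up (side (R.child (edgeSide e) e)) (R.child (edgeSide e) e)))
      depth-child rewrite side-child (edgeSide e) e = R.depth-child (edgeSide e) e
    ... | ()

    child-injective : Injective _≡_ _≡_ child
    child-injective {zero}  {zero}  _  = refl
    child-injective {zero}  {suc e} eq = contradiction (sym eq) (child≢b e)
    child-injective {suc d} {zero}  eq = contradiction eq (child≢b d)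
    -- Equal children lie on one side, so both edges take their child from the same rooting.
    child-injective {suc d} {suc e} eq = cong suc (injective
      (trans (sym (side-child _ d)) (trans (cong side eq) (side-child _ e))) eq)
      where
      injective : ∀ {s t} → s ≡ t → R.child s d ≡ R.child t e → d ≡ e
      injective refl = R.child-injective _

    up-b : up b ≡ a
    up-b with b Fin.≟ b
    ... | yes _  = refl
    ... | no b≢b = contradiction refl b≢b

    up-child : ∀ e → up (child (suc e)) ≡ R.parent (edgeSide e) e
    up-child e with R.child (edgeSide e) e Fin.≟ b
    ... | yes eq = contradiction eq (child≢b e)
    ... | no _   = cong (λ s → R.up s (R.child (edgeSide e) e)) (side-child (edgeSide e) e)

    offset-b : offset (side b) ≡ suc (R.depth (side a) a)
    offset-b with side b ≟ side b
    ... | yes _  = refl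
    ... | no b≢b = contradiction refl b≢b

    offset-≢ : ∀ {s} → s ≢ side b → offset s ≡ 0
    offset-≢ {s} s≢ with s ≟ side b
    ... | yes eq = contradiction eq s≢
    ... | no _   = refl

    depth′-≢ : ∀ {x} → side x ≢ side b → depth′ x ≡ R.depth (side x) x
    depth′-≢ x≢ = cong (_+ _) (offset-≢ x≢)

    joins : ∀ e → Joins G e (up (child e)) (child e)
    joins zero    rewrite up-b       = ab
    joins (suc e) rewrite up-child e = R.joins (edgeSide e) e

    depth′-child : ∀ e → depth′ (child e) ≡ suc (depth′ (up (child e)))
    depth′-child zero rewrite up-b = begin
      depth′ b                     ≡⟨ cong₂ _+_ offset-b b-root ⟩
      suc (R.depth (side a) a) + 0 ≡⟨ ℕ.+-identityʳ _ ⟩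
      suc (R.depth (side a) a)     ≡⟨ cong suc (depth′-≢ a≢b) ⟨
      suc (depth′ a)               ∎
      where open ≡-Reasoning
    depth′-child (suc e) rewrite up-child e = let s = edgeSide e in begin
      depth′ (R.child s e)                     ≡⟨ depth′-at (side-child s e) ⟩
      offset s + R.depth s (R.child s e)       ≡⟨ cong (offset s +_) (R.depth-child s e) ⟩
      offset s + suc (R.depth s (R.parent s e)) ≡⟨ ℕ.+-suc (offset s) _ ⟩
      suc (offset s + R.depth s (R.parent s e)) ≡⟨ cong suc (depth′-at (side-parent s e)) ⟨
      suc (depth′ (R.parent s e))              ∎
      where open ≡-Reasoning

    rooting : Rooting G
    rooting = record
      { up              = up
      ; child           = child
      ; depth           = depth′
      ; child-injective = child-injective
      ; joins           = joins
      ; depth-child     = depth′-child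
      }

  -- The side of `b` is rooted at `b` and all others at `r`; only the former is shifted, so `r`
  -- keeps depth 0.
  rootAt : ∀ {a b} → Joins G zero a b → side a ≢ side b → Rootable G₀ →
           ∀ r → side r ≢ side b → Σ (Rooting G) λ R → depth R r ≡ 0
  rootAt {a} {b} ab a≢b rootable r r≢b = rooting , trans (depth′-≢ r≢b) (isRoot (root-≢ r≢b))
    where
    root : A → Fin m
    root s with s ≟ side b
    ... | yes _ = b
    ... | no _  = r

    root-b : root (side b) ≡ b
    root-b with side b ≟ side b
    ... | yes _  = refl
    ... | no b≢b = contradiction refl b≢b

    root-≢ : ∀ {s} → s ≢ side b → root s ≡ r
    root-≢ {s} s≢ with s ≟ side b
    ... | yes eq = contradiction eq s≢
    ... | no _   = refl

    isRoot : ∀ {s x} → root s ≡ x → depth (proj₁ (rootable (root s))) x ≡ 0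
    isRoot refl = proj₂ (rootable _)

    open Hang ab a≢b (proj₁ ∘ rootable ∘ root) (isRoot root-b)

  -- At least one end of the bridge is not on the side of `r`; the side of that end is hung below
  -- the other end.
  rootable-bridge : side (proj₁ (ends zero)) ≢ side (proj₂ (ends zero)) → Rootable G₀ → Rootable G
  rootable-bridge a≢b rootable r with side r ≟ side (proj₂ (ends zero))
  ... | no r≢b  = rootAt (inj₁ refl) a≢b rootable r r≢b
  ... | yes r≡b = rootAt (inj₂ refl) (≢-sym a≢b) rootable r (λ r≡a → a≢b (trans (sym r≡a) r≡b))

-- Rootability is carried along because it survives adding a bridge and yields both acyclicity and a
-- plane drawing.
record Forest (G : Graph) (k : ℕ) : Set where
  field
    component      : Vertex G → Fin k
    component-ends : ∀ e → component (proj₁ (ends G e)) ≡ component (proj₂ (ends G e))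
    connected      : ∀ {a b} → component a ≡ component b → ∃ (Walk G a b)
    rootable       : Rootable G

edgeless : ∀ n {ends : Fin 0 → Fin n × Fin n} → Forest (graphOf n 0 ends) n
edgeless n = record
  { component      = id
  ; component-ends = λ ()
  ; connected      = λ { refl → 0 , [] }
  ; rootable       = λ _ → record
      { up              = id
      ; child           = λ ()
      ; depth           = λ _ → 0
      ; child-injective = λ { {()} }
      ; joins           = λ ()
      ; depth-child     = λ ()
      } , refl
  }

-- Merging the labels of two components

merge : ∀ {k} {i j : Fin (suc k)} → i ≢ j → Fin (suc k) → Fin k
merge {i = i} i≢j l with i Fin.≟ l
... | yes _  = punchOut i≢j
... | no i≢l = punchOut i≢l

module _ {k} {i j : Fin (suc k)} (i≢j : i ≢ j) where

  merge-i≡merge-j : merge i≢j i ≡ merge i≢j j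
  merge-i≡merge-j with i Fin.≟ i | i Fin.≟ j
  ... | _      | yes i≡j = contradiction i≡j i≢j
  ... | no i≢i | _       = contradiction refl i≢i
  ... | yes _  | no _    = Fin.punchOut-cong i refl

  merge-injective : ∀ l m → merge i≢j l ≡ merge i≢j m →
                    l ≡ m ⊎ (l ≡ i ⊎ l ≡ j) × (m ≡ i ⊎ m ≡ j)
  merge-injective l m eq with i Fin.≟ l | i Fin.≟ m
  ... | yes refl | yes refl = inj₁ refl
  ... | yes refl | no i≢m   = inj₂ (inj₁ refl , inj₂ (sym (Fin.punchOut-injective i≢j i≢m eq)))
  ... | no i≢l   | yes refl = inj₂ (inj₂ (Fin.punchOut-injective i≢l i≢j eq) , inj₁ refl)
  ... | no i≢l   | no i≢m   = inj₁ (Fin.punchOut-injective i≢l i≢m eq)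

  -- Finds an old label, other than `i`, behind every new one.
  merge-punchIn : ∀ l → merge i≢j (punchIn i l) ≡ l
  merge-punchIn l with i Fin.≟ punchIn i l
  ... | yes eq = contradiction (sym eq) (Fin.punchInᵢ≢i i l)
  ... | no i≢  = trans (Fin.punchOut-cong i refl) (Fin.punchOut-punchIn i)

-- The graph after a move

module _ (G : Graph) (u v : Vertex G) where

  private G′ = joinVertices G u v

  liftJoins : ∀ {e a b} → Joins G e a b → Joins G′ (suc (suc e)) (suc a) (suc b)
  liftJoins = Sum.map (cong (Product.map suc suc)) (cong (Product.map suc suc))

  liftWalk : ∀ {a b k} → Walk G a b k → Walk G′ (suc a) (suc b) k
  liftWalk []           = []
  liftWalk (step e j w) = step (suc (suc e)) (liftJoins j) (liftWalk w)

  walkEdges-lift : ∀ {a b k} (w : Walk G a b k) →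
                   walkEdges (liftWalk w) ≡ map (λ e → suc (suc e)) (walkEdges w)
  walkEdges-lift []           = refl
  walkEdges-lift (step e _ w) = cong (suc (suc e) ∷_) (walkEdges-lift w)

  walkVertices-lift : ∀ {a b k} (w : Walk G a b k) →
                      walkVertices (liftWalk w) ≡ map suc (walkVertices w)
  walkVertices-lift []           = refl
  walkVertices-lift (step _ _ w) = cong (suc _ ∷_) (walkVertices-lift w)

  -- The two new edges lead from `u` over the crossbar to `v`, and the path leads back. If `u` and
  -- `v` coincide, the path is empty and the cycle has length 2.
  path⇒cycle : ∀ {k} (w : Walk G v u k) → IsPath w → Cycle G′ (2 + k)
  path⇒cycle w (ue , uv) =
    suc u , step zero (inj₁ refl) (step (suc zero) (inj₁ refl) (liftWalk w)) , s≤s z≤n ,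
    uniqueEdges , uniqueVertices
    where
    uniqueEdges : Unique (zero ∷ suc zero ∷ walkEdges (liftWalk w))
    uniqueEdges = subst (λ es → Unique (zero ∷ suc zero ∷ es)) (sym (walkEdges-lift w))
      (((λ ()) ∷ All.map⁺ (All.universal (λ _ ()) _)) ∷
       All.map⁺ (All.universal (λ _ ()) _) ∷
       Unique.map⁺ (Fin.suc-injective ∘ Fin.suc-injective) ue)

    uniqueVertices : Unique (suc u ∷ zero ∷ walkVertices (liftWalk w))
    uniqueVertices with Unique.map⁺ Fin.suc-injective uv
    ... | u∉ ∷ uw = subst (λ vs → Unique (suc u ∷ zero ∷ vs)) (sym (walkVertices-lift w))
      (((λ ()) ∷ u∉) ∷ All.map⁺ (All.universal (λ _ ()) _) ∷ uw)

  shortCycle : ∃ (Walk G v u) → ∃ λ l → Cycle G′ l × l ≤ suc (#vertices G)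
  shortCycle (_ , w) with walk⇒path w
  ... | k , p , isPath = 2 + k , path⇒cycle p isPath ,
    -- A path of length `k` has `suc k` distinct vertices.
    s≤s (subst (_≤ #vertices G) (cong suc (length-walkVertices p)) (unique⇒length≤ (proj₂ isPath)))

  module _ {k} (F : Forest G (suc k)) where
    open Forest F

    module _ (u≢v : component u ≢ component v) where

      component′ : Vertex G′ → Fin k
      component′ zero    = merge u≢v (component u)
      component′ (suc x) = merge u≢v (component x)

      component′-ends : ∀ e → component′ (proj₁ (ends G′ e)) ≡ component′ (proj₂ (ends G′ e))
      component′-ends zero          = refl
      component′-ends (suc zero)    = merge-i≡merge-j u≢v
      component′-ends (suc (suc e)) = cong (merge u≢v) (component-ends e)

      Joined : Vertex G → Set
      Joined x = component x ≡ component u ⊎ component x ≡ component v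

      liftConnected : ∀ {x y} → component x ≡ component y → ∃ (Walk G′ (suc x) (suc y))
      liftConnected = Product.map₂ liftWalk ∘ connected

      _⁀_ : ∀ {x y z} → ∃ (Walk G′ x y) → ∃ (Walk G′ y z) → ∃ (Walk G′ x z)
      (_ , w) ⁀ (_ , w′) = _ , w ++ʷ w′

      fromCrossbar : ∀ {x} → Joined x → ∃ (Walk G′ zero (suc x))
      fromCrossbar (inj₁ x~u) = (1 , step zero (inj₂ refl) []) ⁀ liftConnected (sym x~u)
      fromCrossbar (inj₂ x~v) = (1 , step (suc zero) (inj₁ refl) []) ⁀ liftConnected (sym x~v)

      toCrossbar : ∀ {x} → Joined x → ∃ (Walk G′ (suc x) zero)
      toCrossbar (inj₁ x~u) = liftConnected x~u ⁀ (1 , step zero (inj₁ refl) [])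
      toCrossbar (inj₂ x~v) = liftConnected x~v ⁀ (1 , step (suc zero) (inj₂ refl) [])

      joined : ∀ {x} → merge u≢v (component u) ≡ merge u≢v (component x) → Joined x
      joined eq = [ inj₁ ∘ sym , proj₂ ]′ (merge-injective u≢v _ _ eq)

      connected′ : ∀ {a b} → component′ a ≡ component′ b → ∃ (Walk G′ a b)
      connected′ {zero}  {zero}  _  = 0 , []
      connected′ {zero}  {suc y} eq = fromCrossbar (joined eq)
      connected′ {suc x} {zero}  eq = toCrossbar (joined (sym eq))
      connected′ {suc x} {suc y} eq =
        [ liftConnected , (λ (x∈ , y∈) → toCrossbar x∈ ⁀ fromCrossbar y∈) ]′
          (merge-injective u≢v _ _ eq)

      -- G′ arises from G and the isolated crossbar vertex by adding two bridges.
      rootable′ : Rootable G′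
      rootable′ = rootable-bridge (ends G′) Fin._≟_ side
        (λ { zero → refl ; (suc e) → component-ends e }) u≢v
        (rootable-bridge (ends G′ ∘ suc) Bool._≟_ isCrossbar (λ _ → refl) (λ ())
          (isolatedVertex u rootable))
        where
        side : Vertex G′ → Fin (suc k)
        -- When the edge at `u` is added, the crossbar vertex is already attached to `v`.
        side zero    = component v
        side (suc x) = component x

        isCrossbar : Vertex G′ → Bool
        isCrossbar zero    = true
        isCrossbar (suc _) = false

      joinForest : Forest G′ k
      joinForest = record
        { component      = component′
        ; component-ends = component′-ends
        ; connected      = connected′
        ; rootable       = rootable′
        }

-- The game

tipsUsed-≤ : ∀ {n} {u v : Fin n} → u ≢ v → (t : Fin n → ℕ) → 1 ≤ t u → 1 ≤ t v →
             ∀ w → tipsUsed u v w ≤ t w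
tipsUsed-≤ {u = u} {v} u≢v t 1≤u 1≤v w with u Fin.≟ w | v Fin.≟ w
... | yes refl | yes refl = contradiction refl u≢v
... | yes refl | no _     = 1≤u
... | no _     | yes refl = 1≤v
... | no _     | no _     = z≤n

tipsUsed-≢ : ∀ {n} {u v w : Fin n} → u ≢ w → v ≢ w → tipsUsed u v w ≡ 0
tipsUsed-≢ {u = u} {v} {w} u≢w v≢w with u Fin.≟ w | v Fin.≟ w
... | yes u≡w | _       = contradiction u≡w u≢w
... | no _    | yes v≡w = contradiction v≡w v≢w
... | no _    | no _    = refl

-- A tip under every label makes each label occur, so `k` is the exact number of trees.
record LiveForest (p : Configuration) (k : ℕ) : Set where
  field
    forest : Forest (graph p) k
  open Forest forest public
  field
    tip : ∀ i → ∃ λ v → component v ≡ i × 1 ≤ tips p v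

live-start : ∀ {n F} {t : Fin n → ℕ} → (∀ i → 1 ≤ t i) → LiveForest (Game.start (BS n F t)) n
live-start {n} 1≤t = record { forest = edgeless n ; tip = λ i → i , refl , 1≤t i }

module _ {p : Configuration} {k} (L : LiveForest p (suc k)) where
  open LiveForest L

  -- The joined tree has the tips of the crossbar; any other tree contains neither `u` nor `v` and
  -- keeps its tip.
  live-join : ∀ {u v} → component u ≢ component v → LiveForest (joinTips p u v) k
  live-join {u} {v} u≢v = record { forest = joinForest (graph p) u v forest u≢v ; tip = tip′ }
    where
    tip′ : ∀ i → ∃ λ x → component′ (graph p) u v forest u≢v x ≡ i × 1 ≤ tips (joinTips p u v) x
    -- `punchIn` avoids the label of `u`, so `i` labels the joined tree exactly when the old label
    -- is that of `v`.
    tip′ i with punchIn (component u) i Fin.≟ component v | tip (punchIn (component u) i)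
    ... | yes eq | _ = zero ,
      trans (merge-i≡merge-j u≢v) (trans (cong (merge u≢v) (sym eq)) (merge-punchIn u≢v i)) ,
      s≤s z≤n
    ... | no i≢v | x , eq , 1≤x = suc x , trans (cong (merge u≢v) eq) (merge-punchIn u≢v i) ,
      subst (λ d → 1 ≤ tips p x ∸ d) (sym (tipsUsed-≢
        (λ u≡x → Fin.punchInᵢ≢i (component u) i (trans (sym eq) (cong component (sym u≡x))))
        (λ v≡x → i≢v (trans (sym eq) (cong component (sym v≡x)))))) 1≤x

  -- Tips in one tree would close a cycle with at most one vertex more than the graph has now, and
  -- `bound` makes this shorter than `g`.
  move-separates : ∀ {g u v} → suc (suc (#vertices (graph p))) ≤ g →
                   Contains (𝒫 g) (graph (joinTips p u v)) → component u ≢ component v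
  move-separates {u = u} {v} bound c u~v with shortCycle (graph p) u v (connected (sym u~v))
  ... | l , cycle , l≤ = ℕ.<⇒≱ (ℕ.≤-trans (s≤s l≤) bound) (g≤cycle c cycle)

-- k counts the remaining moves, which is one less than the number of trees.
ends-after : ∀ {n g} {t : Fin n → ℕ} k {p} → LiveForest p (suc k) →
             suc (suc (#vertices (graph p) + k)) ≤ g → EndsAfterFrom (BS n (𝒫 g) t) k p
-- A single label remains, so any two tips lie in the same tree.
ends-after zero L bound (move u v _ c) =
  move-separates L (subst (λ m → suc (suc m) ≤ _) (ℕ.+-identityʳ _) bound) c Fin1-unique
  where
  Fin1-unique : ∀ {i j : Fin 1} → i ≡ j
  Fin1-unique {zero} {zero} = refl
ends-after {g = g} (suc k) {p} L bound = (_ , firstMove) , next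
  where
  open LiveForest L

  u = proj₁ (tip zero)
  v = proj₁ (tip (suc zero))

  u≢v : component u ≢ component v
  u≢v eq with trans (sym (proj₁ (proj₂ (tip zero)))) (trans eq (proj₁ (proj₂ (tip (suc zero)))))
  ... | ()

  firstMove : Move (𝒫 g) p (joinTips p u v)
  firstMove = move u v
    (tipsUsed-≤ (u≢v ∘ cong component) (tips p)
      (proj₂ (proj₂ (tip zero))) (proj₂ (proj₂ (tip (suc zero)))))
    (rooting⇒∈𝒫 g (proj₁ (LiveForest.rootable (live-join L u≢v) zero)))

  next : ∀ {q} → Move (𝒫 g) p q → EndsAfterFrom _ k q
  next (move _ _ _ c) = ends-after k
    (live-join L (move-separates L (ℕ.≤-trans (s≤s (s≤s (ℕ.m≤m+n _ _))) bound) c))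
    -- A move adds one vertex and lowers `k` by one, so their sum is constant.
    (subst (λ m → suc (suc m) ≤ g) (ℕ.+-suc _ k) bound)

theorem3p1 : (n : ℕ) .{{_ : NonZero n}} (t : Fin n → ℕ) → (∀ i → 1 ≤ t i) →
    (g : ℕ) → g ≥ 2 * n + 1 → EndsExactlyAfter (BS n (𝒫 g) t) (n ∸ 1)
theorem3p1 (suc n) t 1≤t g g≥ =
  -- Here `n` is one less than the number of spots and so equals the number of moves; the required
  -- bound 2 + (n + 1) + n is just 2(n + 1) + 1.
  ends-after n (live-start {F = 𝒫 g} 1≤t) (subst (_≤ g) (size n) g≥)
  where
  size : ∀ n → 2 * suc n + 1 ≡ suc (suc (suc n + n))
  size = ℕ-Solver.solve-∀
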